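{- Let $n\ge 1$ be an integer and let $x\in\mathbb{R}$ with $x\neq \pm 1$, $x\neq 0$, and such that the power $\left(\frac1x\right)^{\odot n}$ is defined. Then $$\left(\frac{1}{x}\right)^{\odot n}=\frac{v_n(x)}{u_n(x)},$$ where $$(u_n(x))_{n=0}^\infty=\mathcal W(1,x,2x,1+x^2),\qquad (v_n(x))_{n=0}^\infty=\mathcal W(0,1,2x,1+x^2).$$
   Context: For real $a,b$ with $ab\neq 1$, put $a\odot b=\frac{a+b}{1-ab}$; this is a (partial) operation, undefined when $ab=1$. The $n$-th power with respect to $\odot$ is given by $a^{\odot 1}=a$ and $a^{\odot n}=a\odot a^{\odot (n-1)}$ for $n\ge 2$; it is defined when all the products occurring in this recursion are defined. $\mathcal W(\alpha,\beta,p,q)$ denotes the linear recurrent sequence $(a_n)_{n=0}^{\infty}$ of order 2 with $a_0=\alpha$, $a_1=\beta$, and $a_n=p\,a_{n-1}-q\,a_{n-2}$ for all $n\ge 2$. -}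

module Defs where

open import Algebra.Apartness.Bundles using (HeytingField)
open import Algebra.Apartness.Structures using (IsHeytingCommutativeRing; IsHeytingField)
open import Algebra.Structures using (IsCommutativeRing)
open import Data.Empty using (⊥)
open import Data.Nat.Base as ℕ using (ℕ; zero; suc)
import Data.Nat.Properties as ℕ
open import Data.Product.Base using (_×_; _,_; ∃-syntax; Σ-syntax; proj₁; proj₂)
open import Data.Rational.Base as ℚ using (ℚ; 0ℚ; 1ℚ; ½; ∣_∣)
import Data.Rational.Properties as ℚ
open import Data.Sum.Base using (_⊎_; inj₁; inj₂; [_,_]′)
open import Data.Unit.Base using (⊤; tt)
open import Level using (0ℓ)
open import Relation.Binary.Definitions using (Cotransitive; Tight)
open import Relation.Binary.PropositionalEquality
  using (_≡_; _≢_; refl; sym; trans; cong; cong₂; subst; subst₂)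
open import Relation.Binary.Structures using (IsEquivalence; IsApartnessRelation)
open import Relation.Nullary using (¬_; yes; no; contradiction)

module Estimates where
  open import Data.Rational.Base using (_+_; _*_; _-_; -_; _≤_; _<_)
  open import Data.Rational.Solver using (module +-*-Solver)
  open +-*-Solver using (solve; _:=_; _:+_; _:*_; _:-_; :-_; con)
  open ℚ.≤-Reasoning

  0<1 : 0ℚ < 1ℚ
  0<1 = ℚ.positive⁻¹ 1ℚ

  <⇒≱ : ∀ {p q} → p < q → ¬ q ≤ p
  <⇒≱ p<q q≤p = ℚ.<-irrefl refl (ℚ.<-≤-trans p<q q≤p)

  half : ∀ {ε} → 0ℚ < ε → 0ℚ < ½ * ε
  half {ε} 0<ε = subst (_< ½ * ε) (ℚ.*-zeroʳ ½) (ℚ.*-monoʳ-<-pos ½ 0<ε)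

  half+half : ∀ ε → ½ * ε + ½ * ε ≡ ε
  half+half ε = trans (sym (ℚ.*-distribʳ-+ ε ½ ½)) (ℚ.*-identityˡ ε)

  *-monoˡ-≤ : ∀ {p q r} → 0ℚ ≤ r → p ≤ q → r * p ≤ r * q
  *-monoˡ-≤ {r = r} 0≤r = ℚ.*-monoˡ-≤-nonNeg r {{ℚ.nonNegative 0≤r}}

  *-monoʳ-≤ : ∀ {p q r} → 0ℚ ≤ r → p ≤ q → p * r ≤ q * r
  *-monoʳ-≤ {r = r} 0≤r = ℚ.*-monoʳ-≤-nonNeg r {{ℚ.nonNegative 0≤r}}

  *-monoˡ-< : ∀ {p q r} → 0ℚ < r → p < q → r * p < r * q
  *-monoˡ-< {r = r} 0<r = ℚ.*-monoʳ-<-pos r {{ℚ.positive 0<r}}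

  *-monoʳ-< : ∀ {p q r} → 0ℚ < r → p < q → p * r < q * r
  *-monoʳ-< {r = r} 0<r = ℚ.*-monoˡ-<-pos r {{ℚ.positive 0<r}}

  *-pos : ∀ {p q} → 0ℚ < p → 0ℚ < q → 0ℚ < p * q
  *-pos {p} {q} 0<p 0<q = subst (_< p * q) (ℚ.*-zeroʳ p) (*-monoˡ-< 0<p 0<q)

  -- Total inverse on ℚ, with the junk value inv 0 = 0.
  inv : ℚ → ℚ
  inv q with q ℚ.≟ 0ℚ
  ... | yes _   = 0ℚ
  ... | no  q≢0 = ℚ.1/_ q {{ℚ.≢-nonZero q≢0}}

  *-inv : ∀ {q} → q ≢ 0ℚ → q * inv q ≡ 1ℚ
  *-inv {q} q≢0 with q ℚ.≟ 0ℚ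
  ... | yes q≡0 = contradiction q≡0 q≢0
  ... | no  q≢0 = ℚ.*-inverseʳ q {{ℚ.≢-nonZero q≢0}}

  pos⇒≢0 : ∀ {q} → 0ℚ < q → q ≢ 0ℚ
  pos⇒≢0 0<q q≡0 = ℚ.<-irrefl (sym q≡0) 0<q

  inv-pos : ∀ {q} → 0ℚ < q → 0ℚ < inv q
  inv-pos {q} 0<q = ℚ.≰⇒> λ inv≤0 → <⇒≱ 0<1
    (subst₂ _≤_ (*-inv (pos⇒≢0 0<q)) (ℚ.*-zeroʳ q) (*-monoˡ-≤ (ℚ.<⇒≤ 0<q) inv≤0))

  ∣∣-pos : ∀ {δ q} → 0ℚ < δ → δ ≤ ∣ q ∣ → q ≢ 0ℚ
  ∣∣-pos 0<δ δ≤ refl = <⇒≱ 0<δ δ≤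

  dist-refl : ∀ {ε} p → 0ℚ < ε → ∣ p - p ∣ < ε
  dist-refl {ε} p 0<ε = subst (_< ε) (cong ∣_∣ (sym (ℚ.+-inverseʳ p))) 0<ε

  dist-sym : ∀ p q → ∣ p - q ∣ ≡ ∣ q - p ∣
  dist-sym p q = trans (sym (ℚ.∣-p∣≡∣p∣ (p - q)))
    (cong ∣_∣ (solve 2 (λ p q → :- (p :- q) := q :- p) refl p q))

  dist-tri : ∀ p q r → ∣ p - r ∣ ≤ ∣ p - q ∣ + ∣ q - r ∣
  dist-tri p q r = subst (λ t → ∣ t ∣ ≤ ∣ p - q ∣ + ∣ q - r ∣)
    (solve 3 (λ p q r → (p :- q) :+ (q :- r) := p :- r) refl p q r)
    (ℚ.∣p+q∣≤∣p∣+∣q∣ (p - q) (q - r))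

  p-0 : ∀ p → p - 0ℚ ≡ p
  p-0 = ℚ.+-identityʳ

  ∣∣-tri : ∀ p q → ∣ p ∣ ≤ ∣ p - q ∣ + ∣ q ∣
  ∣∣-tri p q = subst₂ (λ s t → ∣ s ∣ ≤ ∣ p - q ∣ + ∣ t ∣) (p-0 p) (p-0 q) (dist-tri p q 0ℚ)

  halves< : ∀ {p q ε} → p < ½ * ε → q < ½ * ε → p + q < ε
  halves< {p} {q} {ε} p< q< = subst (p + q <_) (half+half ε) (ℚ.+-mono-< p< q<)

  halves≤ : ∀ {p q ε} → ε ≤ p + q → (½ * ε ≤ p) ⊎ (½ * ε ≤ q)
  halves≤ {p} {q} {ε} ε≤ with ½ * ε ℚ.≤? p | ½ * ε ℚ.≤? q
  ... | yes h | _     = inj₁ h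
  ... | no  _ | yes h = inj₂ h
  ... | no  h | no  k = contradiction ε≤ (<⇒≱ (halves< {ε = ε} (ℚ.≰⇒> h) (ℚ.≰⇒> k)))

  close-trans : ∀ {ε} p q r → ∣ p - q ∣ < ½ * ε → ∣ q - r ∣ < ½ * ε → ∣ p - r ∣ < ε
  close-trans {ε} p q r h k = ℚ.≤-<-trans (dist-tri p q r) (halves< {ε = ε} h k)

  close-+ : ∀ {ε} a b c d → ∣ a - c ∣ < ½ * ε → ∣ b - d ∣ < ½ * ε → ∣ (a + b) - (c + d) ∣ < ε
  close-+ {ε} a b c d h k = subst (λ t → ∣ t ∣ < ε)
    (solve 4 (λ a b c d → (a :- c) :+ (b :- d) := (a :+ b) :- (c :+ d)) refl a b c d)
    (ℚ.≤-<-trans (ℚ.∣p+q∣≤∣p∣+∣q∣ (a - c) (b - d)) (halves< {ε = ε} h k))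

  close-neg : ∀ {ε} a c → ∣ a - c ∣ < ε → ∣ (- a) - (- c) ∣ < ε
  close-neg {ε} a c = subst (_< ε) (trans (dist-sym a c)
    (cong ∣_∣ (solve 2 (λ a c → c :- a := :- a :- :- c) refl a c)))

  *-tol : ℚ → ℚ → ℚ
  *-tol B ε = inv B * (½ * ε)

  *-tol-pos : ∀ {B ε} → 0ℚ < B → 0ℚ < ε → 0ℚ < *-tol B ε
  *-tol-pos 0<B 0<ε = *-pos (inv-pos 0<B) (half 0<ε)

  *-tol-bound : ∀ {B ε p q} → 0ℚ < B → 0ℚ ≤ q → p ≤ B → q < *-tol B ε → p * q < ½ * ε
  *-tol-bound {B} {ε} {p} {q} 0<B 0≤q p≤B q< = begin-strict
    p * q                  ≤⟨ *-monoʳ-≤ 0≤q p≤B ⟩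
    B * q                  <⟨ *-monoˡ-< 0<B q< ⟩
    B * (inv B * (½ * ε))  ≡⟨ ℚ.*-assoc B (inv B) (½ * ε) ⟨
    (B * inv B) * (½ * ε)  ≡⟨ cong (_* (½ * ε)) (*-inv (pos⇒≢0 0<B)) ⟩
    1ℚ * (½ * ε)           ≡⟨ ℚ.*-identityˡ (½ * ε) ⟩
    ½ * ε                  ∎

  close-* : ∀ {A B ε} a b c d → 0ℚ < A → 0ℚ < B → ∣ a ∣ ≤ A → ∣ d ∣ ≤ B →
            ∣ b - d ∣ < *-tol A ε → ∣ a - c ∣ < *-tol B ε → ∣ a * b - c * d ∣ < ε
  close-* {A} {B} {ε} a b c d 0<A 0<B a≤A d≤B h k = begin-strict
    ∣ a * b - c * d ∣                      ≡⟨ cong ∣_∣ (solve 4 (λ a b c d →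
                                               a :* b :- c :* d := a :* (b :- d) :+ d :* (a :- c))
                                               refl a b c d) ⟩
    ∣ a * (b - d) + d * (a - c) ∣          ≤⟨ ℚ.∣p+q∣≤∣p∣+∣q∣ (a * (b - d)) (d * (a - c)) ⟩
    ∣ a * (b - d) ∣ + ∣ d * (a - c) ∣      ≡⟨ cong₂ _+_ (ℚ.∣p*q∣≡∣p∣*∣q∣ a (b - d))
                                                        (ℚ.∣p*q∣≡∣p∣*∣q∣ d (a - c)) ⟩
    ∣ a ∣ * ∣ b - d ∣ + ∣ d ∣ * ∣ a - c ∣  <⟨ halves< {ε = ε} (*-tol-bound {A} {ε} 0<A (ℚ.0≤∣p∣ (b - d)) a≤A h)
                                                      (*-tol-bound {B} {ε} 0<B (ℚ.0≤∣p∣ (a - c)) d≤B k) ⟩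
    ε                                      ∎

  close-inv : ∀ {δ ε} a b → 0ℚ < δ → 0ℚ < ε → δ ≤ ∣ a ∣ → δ ≤ ∣ b ∣ →
              ∣ a - b ∣ < δ * δ * ε → ∣ inv a - inv b ∣ < ε
  close-inv {δ} {ε} a b 0<δ 0<ε δ≤a δ≤b h = ℚ.≰⇒> λ ε≤ → <⇒≱ h (begin
    δ * δ * ε                          ≤⟨ *-monoˡ-≤ (ℚ.<⇒≤ (*-pos 0<δ 0<δ)) ε≤ ⟩
    δ * δ * D                          ≤⟨ *-monoʳ-≤ (ℚ.0≤∣p∣ (inv a - inv b)) δδ≤ ⟩
    ∣ a ∣ * ∣ b ∣ * D                  ≡⟨ cong (_* D) (ℚ.∣p*q∣≡∣p∣*∣q∣ a b) ⟨
    ∣ a * b ∣ * D                      ≡⟨ ℚ.∣p*q∣≡∣p∣*∣q∣ (a * b) (inv a - inv b) ⟨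
    ∣ a * b * (inv a - inv b) ∣        ≡⟨ cong ∣_∣ (solve 4 (λ a b a' b' →
                                            a :* b :* (a' :- b') := b :* (a :* a') :- a :* (b :* b'))
                                            refl a b (inv a) (inv b)) ⟩
    ∣ b * (a * inv a) - a * (b * inv b) ∣ ≡⟨ cong₂ (λ s t → ∣ b * s - a * t ∣)
                                            (*-inv (∣∣-pos {q = a} 0<δ δ≤a))
                                            (*-inv (∣∣-pos {q = b} 0<δ δ≤b)) ⟩
    ∣ b * 1ℚ - a * 1ℚ ∣                ≡⟨ cong₂ (λ s t → ∣ s - t ∣) (ℚ.*-identityʳ b) (ℚ.*-identityʳ a) ⟩
    ∣ b - a ∣                          ≡⟨ dist-sym b a ⟩
    ∣ a - b ∣                          ∎)
    where
    D = ∣ inv a - inv b ∣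
    δδ≤ : δ * δ ≤ ∣ a ∣ * ∣ b ∣
    δδ≤ = ℚ.≤-trans (*-monoˡ-≤ (ℚ.<⇒≤ 0<δ) δ≤b) (*-monoʳ-≤ (ℚ.0≤∣p∣ b) δ≤a)

  bounded-step : ∀ p q → ∣ p - q ∣ < 1ℚ → ∣ p ∣ ≤ ∣ q ∣ + 1ℚ
  bounded-step p q h = begin
    ∣ p ∣              ≤⟨ ∣∣-tri p q ⟩
    ∣ p - q ∣ + ∣ q ∣  ≡⟨ ℚ.+-comm ∣ p - q ∣ ∣ q ∣ ⟩
    ∣ q ∣ + ∣ p - q ∣  ≤⟨ ℚ.+-monoʳ-≤ ∣ q ∣ (ℚ.<⇒≤ h) ⟩
    ∣ q ∣ + 1ℚ         ∎

  ∣∣+1-pos : ∀ q → 0ℚ < ∣ q ∣ + 1ℚ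
  ∣∣+1-pos q = ℚ.positive⁻¹ (∣ q ∣ + 1ℚ) {{ℚ.nonNeg+pos⇒pos ∣ q ∣ {{ℚ.∣-∣-nonNeg q}} 1ℚ}}

  away : ∀ {δ} p q → δ ≤ ∣ p ∣ → ∣ p - q ∣ < ½ * δ → ½ * δ ≤ ∣ q ∣
  away {δ} p q δ≤p h = [ (λ k → contradiction k (<⇒≱ h)) , (λ k → k) ]′
    (halves≤ {∣ p - q ∣} {∣ q ∣} {δ} (ℚ.≤-trans δ≤p (∣∣-tri p q)))

  *≈1⇒away : ∀ {B} w z → 0ℚ < B → ∣ z ∣ ≤ B → ∣ w * z - 1ℚ ∣ < ½ → inv B * ½ ≤ ∣ w ∣
  *≈1⇒away {B} w z 0<B z≤B h = begin
    inv B * ½              ≤⟨ *-monoˡ-≤ (ℚ.<⇒≤ (inv-pos 0<B)) ½≤ ⟩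
    inv B * ∣ w * z ∣      ≡⟨ cong (inv B *_) (ℚ.∣p*q∣≡∣p∣*∣q∣ w z) ⟩
    inv B * (∣ w ∣ * ∣ z ∣) ≤⟨ *-monoˡ-≤ (ℚ.<⇒≤ (inv-pos 0<B)) (*-monoˡ-≤ (ℚ.0≤∣p∣ w) z≤B) ⟩
    inv B * (∣ w ∣ * B)    ≡⟨ solve 3 (λ i w B → i :* (w :* B) := (B :* i) :* w) refl (inv B) ∣ w ∣ B ⟩
    (B * inv B) * ∣ w ∣    ≡⟨ cong (_* ∣ w ∣) (*-inv (pos⇒≢0 0<B)) ⟩
    1ℚ * ∣ w ∣             ≡⟨ ℚ.*-identityˡ ∣ w ∣ ⟩
    ∣ w ∣                  ∎
    where
    ½≤ : ½ ≤ ∣ w * z ∣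
    ½≤ = subst (_≤ ∣ w * z ∣) (ℚ.*-identityʳ ½)
      (away {1ℚ} 1ℚ (w * z) ℚ.≤-refl (subst (_< ½) (dist-sym (w * z) 1ℚ) h))

open Estimates

Eventually : (ℕ → Set) → Set
Eventually P = ∃[ N ] ∀ n → N ℕ.≤ n → P n

Eventually₂ : (ℕ → ℕ → Set) → Set
Eventually₂ P = ∃[ N ] ∀ m n → N ℕ.≤ m → N ℕ.≤ n → P m n

map : ∀ {P Q : ℕ → Set} → (∀ n → P n → Q n) → Eventually P → Eventually Q
map f (N , p) = N , λ n h → f n (p n h)

map₂ : ∀ {P Q : ℕ → ℕ → Set} → (∀ m n → P m n → Q m n) → Eventually₂ P → Eventually₂ Q
map₂ f (N , p) = N , λ m n h k → f m n (p m n h k)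

infixr 5 _∩_ _∩₂_

_∩_ : ∀ {P Q} → Eventually P → Eventually Q → Eventually (λ n → P n × Q n)
(M , p) ∩ (N , q) = M ℕ.⊔ N , λ n h →
  p n (ℕ.m⊔n≤o⇒m≤o M N h) , q n (ℕ.m⊔n≤o⇒n≤o M N h)

_∩₂_ : ∀ {P Q} → Eventually₂ P → Eventually₂ Q → Eventually₂ (λ m n → P m n × Q m n)
(M , p) ∩₂ (N , q) = M ℕ.⊔ N , λ m n h k →
  p m n (ℕ.m⊔n≤o⇒m≤o M N h) (ℕ.m⊔n≤o⇒m≤o M N k) ,
  q m n (ℕ.m⊔n≤o⇒n≤o M N h) (ℕ.m⊔n≤o⇒n≤o M N k)

both : ∀ {P} → Eventually P → Eventually₂ (λ m n → P m × P n)
both (N , p) = N , λ m n h k → p m h , p n k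

witness : ∀ {P} → Eventually P → ∃[ n ] P n
witness (N , p) = N , p N ℕ.≤-refl

-- Real numbers are Cauchy sequences of rationals, compared by _≈_ rather
-- than _≡_.  Eta is off so that conversion checking never unfolds the
-- Cauchy proofs.
record ℝ : Set where
  no-eta-equality
  constructor mkℝ
  field
    seq    : ℕ → ℚ
    cauchy : ∀ ε → 0ℚ ℚ.< ε → Eventually₂ λ m n → ∣ seq m ℚ.- seq n ∣ ℚ.< ε

open ℝ public

infix 4 _≈_ _#_

record _≈_ (x y : ℝ) : Set where
  no-eta-equality
  constructor mk≈
  field
    close : ∀ ε → 0ℚ ℚ.< ε → Eventually λ n → ∣ seq x n ℚ.- seq y n ∣ ℚ.< ε

open _≈_ public

-- The constructive form of x ≠ y.  By #-tight below, excluded middle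
-- makes it equivalent to ¬ x ≈ y.
record _#_ (x y : ℝ) : Set where
  no-eta-equality
  constructor mk#
  field
    gap   : ℚ
    gap>0 : 0ℚ ℚ.< gap
    apart : Eventually λ n → gap ℚ.≤ ∣ seq x n ℚ.- seq y n ∣

open _#_ public

bound : ∀ x → ∃[ B ] 0ℚ ℚ.< B × Eventually (λ n → ∣ seq x n ∣ ℚ.≤ B)
bound x = let N , c = cauchy x 1ℚ 0<1 in
  ∣ seq x N ∣ ℚ.+ 1ℚ , ∣∣+1-pos (seq x N) ,
  (N , λ n h → bounded-step (seq x n) (seq x N) (c n N h ℕ.≤-refl))

fromℚ : ℚ → ℝ
seq    (fromℚ q) _     = q
cauchy (fromℚ q) ε 0<ε = 0 , λ _ _ _ _ → dist-refl q 0<ε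

0ℝ 1ℝ : ℝ
0ℝ = fromℚ 0ℚ
1ℝ = fromℚ 1ℚ

infix  8 -_
infixl 7 _*_
infixl 6 _+_ _-_

_+_ : ℝ → ℝ → ℝ
seq (x + y) n = seq x n ℚ.+ seq y n
cauchy (x + y) ε 0<ε =
  map₂ (λ m n (p , q) → close-+ {ε} (seq x m) (seq y m) (seq x n) (seq y n) p q)
       (cauchy x (½ ℚ.* ε) (half 0<ε) ∩₂ cauchy y (½ ℚ.* ε) (half 0<ε))

-_ : ℝ → ℝ
seq (- x) n = ℚ.- seq x n
cauchy (- x) ε 0<ε =
  map₂ (λ m n → close-neg {ε} (seq x m) (seq x n)) (cauchy x ε 0<ε)

_-_ : ℝ → ℝ → ℝ
x - y = x + (- y)

_*_ : ℝ → ℝ → ℝ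
seq (x * y) n = seq x n ℚ.* seq y n
cauchy (x * y) ε 0<ε =
  let A , 0<A , a = bound x
      B , 0<B , b = bound y
  in map₂ (λ m n ((am , _) , (_ , bn) , p , q) →
             close-* {A} {B} {ε} (seq x m) (seq y m) (seq x n) (seq y n) 0<A 0<B am bn q p)
          (both a ∩₂ both b ∩₂ cauchy x (*-tol B ε) (*-tol-pos 0<B 0<ε)
                            ∩₂ cauchy y (*-tol A ε) (*-tol-pos 0<A 0<ε))

#0⇒away : ∀ {x} (x#0 : x # 0ℝ) → Eventually λ n → gap x#0 ℚ.≤ ∣ seq x n ∣
#0⇒away {x} x#0 = map (λ n → subst (λ t → gap x#0 ℚ.≤ ∣ t ∣) (p-0 (seq x n))) (apart x#0)

recip : (x : ℝ) → x # 0ℝ → ℝ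
seq (recip x x#0) n = inv (seq x n)
cauchy (recip x x#0) ε 0<ε =
  map₂ (λ m n ((am , an) , c) →
          close-inv {gap x#0} {ε} (seq x m) (seq x n) (gap>0 x#0) 0<ε am an c)
       (both (#0⇒away x#0) ∩₂
        cauchy x (gap x#0 ℚ.* gap x#0 ℚ.* ε) (*-pos (*-pos (gap>0 x#0) (gap>0 x#0)) 0<ε))

infixl 7 _/_[_]

_/_[_] : (x y : ℝ) → y # 0ℝ → ℝ
x / y [ y#0 ] = x * recip y y#0

eventually≡⇒≈ : ∀ {x y} → Eventually (λ n → seq x n ≡ seq y n) → x ≈ y
eventually≡⇒≈ {x} {y} e = mk≈ λ ε 0<ε →
  map (λ n h → subst (λ t → ∣ seq x n ℚ.- t ∣ ℚ.< ε) h (dist-refl (seq x n) 0<ε)) e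

pointwise⇒≈ : ∀ {x y} → (∀ n → seq x n ≡ seq y n) → x ≈ y
pointwise⇒≈ h = eventually≡⇒≈ (0 , λ n _ → h n)

≈-isEquivalence : IsEquivalence _≈_
≈-isEquivalence = record
  { refl  = pointwise⇒≈ λ _ → refl
  ; sym   = λ {x} {y} x≈y → mk≈ λ ε 0<ε →
      map (λ n → subst (ℚ._< ε) (dist-sym (seq x n) (seq y n))) (close x≈y ε 0<ε)
  ; trans = λ {x} {y} {z} x≈y y≈z → mk≈ λ ε 0<ε →
      map (λ n (h , k) → close-trans {ε} (seq x n) (seq y n) (seq z n) h k)
          (close x≈y (½ ℚ.* ε) (half 0<ε) ∩ close y≈z (½ ℚ.* ε) (half 0<ε))
  }

+-cong : ∀ {x y u v} → x ≈ y → u ≈ v → x + u ≈ y + v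
+-cong {x} {y} {u} {v} x≈y u≈v = mk≈ λ ε 0<ε →
  map (λ n (h , k) → close-+ {ε} (seq x n) (seq u n) (seq y n) (seq v n) h k)
      (close x≈y (½ ℚ.* ε) (half 0<ε) ∩ close u≈v (½ ℚ.* ε) (half 0<ε))

-‿cong : ∀ {x y} → x ≈ y → - x ≈ - y
-‿cong {x} {y} x≈y = mk≈ λ ε 0<ε →
  map (λ n → close-neg {ε} (seq x n) (seq y n)) (close x≈y ε 0<ε)

*-cong : ∀ {x y u v} → x ≈ y → u ≈ v → x * u ≈ y * v
*-cong {x} {y} {u} {v} x≈y u≈v = mk≈ λ ε 0<ε →
  let A , 0<A , a = bound x
      B , 0<B , b = bound v
  in map (λ n (a , b , h , k) →
            close-* {A} {B} {ε} (seq x n) (seq u n) (seq y n) (seq v n) 0<A 0<B a b h k)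
         (a ∩ b ∩ close u≈v (*-tol A ε) (*-tol-pos 0<A 0<ε)
                ∩ close x≈y (*-tol B ε) (*-tol-pos 0<B 0<ε))

+-assoc : ∀ x y z → (x + y) + z ≈ x + (y + z)
+-assoc x y z = pointwise⇒≈ λ n → ℚ.+-assoc (seq x n) (seq y n) (seq z n)

+-comm : ∀ x y → x + y ≈ y + x
+-comm x y = pointwise⇒≈ λ n → ℚ.+-comm (seq x n) (seq y n)

+-identityˡ : ∀ x → 0ℝ + x ≈ x
+-identityˡ x = pointwise⇒≈ λ n → ℚ.+-identityˡ (seq x n)

+-identityʳ : ∀ x → x + 0ℝ ≈ x
+-identityʳ x = pointwise⇒≈ λ n → ℚ.+-identityʳ (seq x n)

+-inverseˡ : ∀ x → - x + x ≈ 0ℝ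
+-inverseˡ x = pointwise⇒≈ λ n → ℚ.+-inverseˡ (seq x n)

+-inverseʳ : ∀ x → x - x ≈ 0ℝ
+-inverseʳ x = pointwise⇒≈ λ n → ℚ.+-inverseʳ (seq x n)

*-assoc : ∀ x y z → (x * y) * z ≈ x * (y * z)
*-assoc x y z = pointwise⇒≈ λ n → ℚ.*-assoc (seq x n) (seq y n) (seq z n)

*-comm : ∀ x y → x * y ≈ y * x
*-comm x y = pointwise⇒≈ λ n → ℚ.*-comm (seq x n) (seq y n)

*-identityˡ : ∀ x → 1ℝ * x ≈ x
*-identityˡ x = pointwise⇒≈ λ n → ℚ.*-identityˡ (seq x n)

*-identityʳ : ∀ x → x * 1ℝ ≈ x
*-identityʳ x = pointwise⇒≈ λ n → ℚ.*-identityʳ (seq x n)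

*-distribˡ-+ : ∀ x y z → x * (y + z) ≈ x * y + x * z
*-distribˡ-+ x y z = pointwise⇒≈ λ n → ℚ.*-distribˡ-+ (seq x n) (seq y n) (seq z n)

*-distribʳ-+ : ∀ x y z → (y + z) * x ≈ y * x + z * x
*-distribʳ-+ x y z = pointwise⇒≈ λ n → ℚ.*-distribʳ-+ (seq x n) (seq y n) (seq z n)

isCommutativeRing : IsCommutativeRing _≈_ _+_ _*_ -_ 0ℝ 1ℝ
isCommutativeRing = record
  { isRing = record
    { +-isAbelianGroup = record
      { isGroup = record
        { isMonoid = record
          { isSemigroup = record
            { isMagma = record { isEquivalence = ≈-isEquivalence ; ∙-cong = +-cong }
            ; assoc   = +-assoc
            }
          ; identity = +-identityˡ , +-identityʳ
          }
        ; inverse = +-inverseˡ , +-inverseʳ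
        ; ⁻¹-cong = -‿cong
        }
      ; comm = +-comm
      }
    ; *-cong     = *-cong
    ; *-assoc    = *-assoc
    ; *-identity = *-identityˡ , *-identityʳ
    ; distrib    = *-distribˡ-+ , *-distribʳ-+
    }
  ; *-comm = *-comm
  }

≈⇒¬# : ∀ {x y} → x ≈ y → ¬ x # y
≈⇒¬# x≈y x#y =
  let _ , h , k = witness (close x≈y (gap x#y) (gap>0 x#y) ∩ apart x#y) in <⇒≱ h k

#-sym : ∀ {x y} → x # y → y # x
#-sym {x} {y} x#y = mk# (gap x#y) (gap>0 x#y)
  (map (λ n → subst (gap x#y ℚ.≤_) (dist-sym (seq x n) (seq y n))) (apart x#y))

-- One sufficiently late index already decides between apartness and closeness.
late-gap⇒# : ∀ {x y δ} → 0ℚ ℚ.< δ → ∀ N →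
  (∀ m n → N ℕ.≤ m → N ℕ.≤ n → ∣ seq (x - y) m ℚ.- seq (x - y) n ∣ ℚ.< ½ ℚ.* δ) →
  ∀ m → N ℕ.≤ m → δ ℚ.≤ ∣ seq x m ℚ.- seq y m ∣ → x # y
late-gap⇒# {x} {y} {δ} 0<δ N c m N≤m δ≤ = mk# (½ ℚ.* δ) (half 0<δ)
  (N , λ n N≤n → away {δ} (seq (x - y) m) (seq (x - y) n) δ≤ (c m n N≤m N≤n))

#-cotrans : Cotransitive _#_
#-cotrans {x} {y} x#y z =
  let M , p = cauchy (x - z) (½ ℚ.* (½ ℚ.* gap x#y)) (half (half (gap>0 x#y)))
      N , q = cauchy (z - y) (½ ℚ.* (½ ℚ.* gap x#y)) (half (half (gap>0 x#y)))
      i , M≤i , N≤i , a = witness ((M , λ _ h → h) ∩ (N , λ _ h → h) ∩ apart x#y)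
  in [ (λ h → inj₁ (late-gap⇒# {x} {z} {½ ℚ.* gap x#y} (half (gap>0 x#y)) M p i M≤i h))
     , (λ h → inj₂ (late-gap⇒# {z} {y} {½ ℚ.* gap x#y} (half (gap>0 x#y)) N q i N≤i h)) ]′
     (halves≤ {∣ seq x i ℚ.- seq z i ∣} {∣ seq z i ℚ.- seq y i ∣} {gap x#y}
       (ℚ.≤-trans a (dist-tri (seq x i) (seq z i) (seq y i))))

#-tight : Tight _≈_ _#_
#-tight x y = ¬#⇒≈ , ≈⇒¬#
  where
  ¬#⇒≈ : ¬ x # y → x ≈ y
  ¬#⇒≈ ¬x#y = mk≈ close′
    where
    close′ : ∀ ε → 0ℚ ℚ.< ε → Eventually λ n → ∣ seq x n ℚ.- seq y n ∣ ℚ.< ε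
    close′ ε 0<ε =
      let N , c = cauchy (x - y) (½ ℚ.* ε) (half 0<ε)
      in N , λ n N≤n → ℚ.≰⇒> λ ε≤ → ¬x#y (late-gap⇒# {x} {y} {ε} 0<ε N c n N≤n ε≤)

*-recip : ∀ x (x#0 : x # 0ℝ) → x * recip x x#0 ≈ 1ℝ
*-recip x x#0 = eventually≡⇒≈ (map (λ n h → *-inv (∣∣-pos {q = seq x n} (gap>0 x#0) h)) (#0⇒away x#0))

#⇒-#0 : ∀ {x y} → x # y → x - y # 0ℝ
#⇒-#0 {x} {y} x#y = mk# (gap x#y) (gap>0 x#y)
  (map (λ n → subst (λ t → gap x#y ℚ.≤ ∣ t ∣) (sym (p-0 (seq (x - y) n)))) (apart x#y))

-*≈1⇒# : ∀ {x y} z → (x - y) * z ≈ 1ℝ → x # y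
-*≈1⇒# {x} {y} z h =
  let B , 0<B , b = bound z
  in mk# (inv B ℚ.* ½) (*-pos (inv-pos 0<B) (ℚ.positive⁻¹ ½))
       (map (λ n (b , c) → *≈1⇒away {B} (seq (x - y) n) (seq z n) 0<B b c)
            (b ∩ close h ½ (ℚ.positive⁻¹ ½)))

isHeytingField : IsHeytingField _≈_ _#_ _+_ _*_ -_ 0ℝ 1ℝ
isHeytingField = record
  { isHeytingCommutativeRing = record
    { isCommutativeRing   = isCommutativeRing
    ; isApartnessRelation = record { irrefl = ≈⇒¬# ; sym = #-sym ; cotrans = #-cotrans }
    ; #⇒invertible = λ {x} {y} x#y →
        let r = recip (x - y) (#⇒-#0 x#y)
            e = *-recip (x - y) (#⇒-#0 x#y)
        in r , IsEquivalence.trans ≈-isEquivalence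
                 (*-comm r (x - y)) e , e
    ; invertible⇒# = λ (z , _ , e) → -*≈1⇒# z e
    }
  ; tight = #-tight
  }

ℝ-heytingField : HeytingField 0ℓ 0ℓ 0ℓ
ℝ-heytingField = record { isHeytingField = isHeytingField }

infixl 7 _⊙_[_]

_⊙_[_] : (a b : ℝ) → a * b # 1ℝ → ℝ
a ⊙ b [ ab#1 ] = (a + b) / (1ℝ - a * b) [ #⇒-#0 (#-sym ab#1) ]

-- There is no zeroth power: recursion starts at exponent 1.
PowerDefined : ℝ → ℕ → Set
power        : (a : ℝ) (n : ℕ) → PowerDefined a n → ℝ

PowerDefined a 0             = ⊥
PowerDefined a 1             = ⊤
PowerDefined a (suc (suc n)) = Σ[ d ∈ PowerDefined a (suc n) ] a * power a (suc n) d # 1ℝ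

power a 1             _            = a
power a (suc (suc n)) (d , ab#1) = a ⊙ power a (suc n) d [ ab#1 ]

𝓦 : (α β p q : ℝ) → ℕ → ℝ
𝓦 α β p q 0             = α
𝓦 α β p q 1             = β
𝓦 α β p q (suc (suc n)) = p * 𝓦 α β p q (suc n) - q * 𝓦 α β p q n

2ℝ : ℝ
2ℝ = 1ℝ + 1ℝ

u : ℝ → ℕ → ℝ
u x = 𝓦 1ℝ x (2ℝ * x) (1ℝ + x * x)

v : ℝ → ℕ → ℝ
v x = 𝓦 0ℝ 1ℝ (2ℝ * x) (1ℝ + x * x)

{-# OPTIONS --safe #-}
module Submission where

-- Formally (x + i)ⁿ = uₙ + i vₙ, so uₙ₊₁ = x uₙ − vₙ and vₙ₊₁ = uₙ + x vₙ.
-- Write a = 1/x and let b be its n-th ⊙-power, with b uₙ = vₙ.  Then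
-- uₙ₊₁ = x uₙ (1 − a b), so uₙ₊₁ is apart from 0 because a b is apart from 1;
-- and (a ⊙ b) uₙ₊₁ = (a + b) x uₙ = uₙ + x vₙ = vₙ₊₁.

open import Defs
open import Algebra.Apartness.Bundles using (HeytingField; HeytingCommutativeRing)
open import Algebra.Bundles using (CommutativeRing)
open import Data.Nat.Base using (ℕ; _≤_; zero; suc)
open import Data.Product.Base using (Σ-syntax; _×_; _,_; proj₁; proj₂)
open import Data.Rational.Base using (0ℚ; 1ℚ)
open import Data.Rational.Solver using (module +-*-Solver)
open import Relation.Binary.PropositionalEquality using (refl)
open +-*-Solver using (solve; _:=_; _:+_; _:*_; _:-_; con)

open HeytingField ℝ-heytingField using ()
  renaming (heytingCommutativeRing to ℝ-heytingCommutativeRing)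
open import Algebra.Apartness.Properties.HeytingCommutativeRing ℝ-heytingCommutativeRing
  using (x#0y#0→xy#0; #-congʳ)
open CommutativeRing (HeytingCommutativeRing.commutativeRing ℝ-heytingCommutativeRing)
  using (setoid; sym; trans; +-congˡ; *-congˡ; *-congʳ) renaming (refl to ≈-refl)
open import Relation.Binary.Reasoning.Setoid setoid

*≈⇒≈/ : ∀ {y z w} (z#0 : z # 0ℝ) → y * z ≈ w → y ≈ w / z [ z#0 ]
*≈⇒≈/ {y} {z} {w} z#0 yz≈w = begin
  y                     ≈⟨ *-identityʳ y ⟨
  y * 1ℝ                ≈⟨ *-congˡ (*-recip z z#0) ⟨
  y * (z * recip z z#0) ≈⟨ *-assoc y z (recip z z#0) ⟨
  y * z * recip z z#0   ≈⟨ *-congʳ yz≈w ⟩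
  w / z [ z#0 ]         ∎

*-1/ : ∀ x (x#0 : x # 0ℝ) → x * (1ℝ / x [ x#0 ]) ≈ 1ℝ
*-1/ x x#0 = trans (*-congˡ (*-identityˡ (recip x x#0))) (*-recip x x#0)

u-v-suc : ∀ x n → u x (suc n) ≈ x * u x n - v x n × v x (suc n) ≈ u x n + x * v x n
u-v-suc x zero =
  -- Real operations act termwise on `seq`, so a polynomial identity over the reals reduces to one
  -- over ℚ, which the ring solver settles.
  pointwise⇒≈ (λ i → solve 1 (λ x → x := x :* con 1ℚ :- con 0ℚ) refl (seq x i)) ,
  pointwise⇒≈ (λ i → solve 1 (λ x → con 1ℚ := con 1ℚ :+ x :* con 0ℚ) refl (seq x i))
u-v-suc x (suc n) = u-step , v-step
  where
  U = u x n
  V = v x n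
  U′ = u x (suc n)
  V′ = v x (suc n)
  U′≈ = proj₁ (u-v-suc x n)
  V′≈ = proj₂ (u-v-suc x n)

  u-step : u x (suc (suc n)) ≈ x * U′ - V′
  u-step = begin
    2ℝ * x * U′ - (1ℝ + x * x) * U
      -- Of the two copies of `x * U′`, only one is expanded by the induction hypothesis: its
      -- `x * x * U` then cancels, leaving `- (U + x * V)`, which is `- V′`.
      ≈⟨ pointwise⇒≈ (λ i → solve 3 (λ x U U′ →
           (con 1ℚ :+ con 1ℚ) :* x :* U′ :- (con 1ℚ :+ x :* x) :* U :=
           x :* U′ :+ (x :* U′ :- (con 1ℚ :+ x :* x) :* U))
           refl (seq x i) (seq U i) (seq U′ i)) ⟩
    x * U′ + (x * U′ - (1ℝ + x * x) * U)
      ≈⟨ +-congˡ (+-cong (*-congˡ U′≈) ≈-refl) ⟩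
    x * U′ + (x * (x * U - V) - (1ℝ + x * x) * U)
      ≈⟨ pointwise⇒≈ (λ i → solve 4 (λ x U V U′ →
           x :* U′ :+ (x :* (x :* U :- V) :- (con 1ℚ :+ x :* x) :* U) :=
           x :* U′ :- (U :+ x :* V))
           refl (seq x i) (seq U i) (seq V i) (seq U′ i)) ⟩
    x * U′ - (U + x * V)
      ≈⟨ +-congˡ (-‿cong V′≈) ⟨
    x * U′ - V′ ∎

  v-step : v x (suc (suc n)) ≈ U′ + x * V′
  v-step = begin
    2ℝ * x * V′ - (1ℝ + x * x) * V
      ≈⟨ pointwise⇒≈ (λ i → solve 3 (λ x V V′ →
           (con 1ℚ :+ con 1ℚ) :* x :* V′ :- (con 1ℚ :+ x :* x) :* V :=
           (x :* V′ :- (con 1ℚ :+ x :* x) :* V) :+ x :* V′)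
           refl (seq x i) (seq V i) (seq V′ i)) ⟩
    (x * V′ - (1ℝ + x * x) * V) + x * V′
      ≈⟨ +-cong (+-cong (*-congˡ V′≈) ≈-refl) ≈-refl ⟩
    (x * (U + x * V) - (1ℝ + x * x) * V) + x * V′
      ≈⟨ pointwise⇒≈ (λ i → solve 4 (λ x U V V′ →
           (x :* (U :+ x :* V) :- (con 1ℚ :+ x :* x) :* V) :+ x :* V′ :=
           (x :* U :- V) :+ x :* V′)
           refl (seq x i) (seq U i) (seq V i) (seq V′ i)) ⟩
    (x * U - V) + x * V′
      ≈⟨ +-cong U′≈ ≈-refl ⟨
    U′ + x * V′ ∎

-- Expanding gives the cross term `x * u * a * b`, which regroups as `(x * a) * (b * u)`. The
-- factored side shows that the next `u` stays apart from 0.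
x*u*[1-a*b] : ∀ {x a b u v} → x * a ≈ 1ℝ → b * u ≈ v →
              (x * u) * (1ℝ - a * b) ≈ x * u - v
x*u*[1-a*b] {x} {a} {b} {u} {v} xa≈1 bu≈v = begin
  (x * u) * (1ℝ - a * b)
    ≈⟨ pointwise⇒≈ (λ i → solve 4 (λ x a b u →
         (x :* u) :* (con 1ℚ :- a :* b) := x :* u :- (x :* a) :* (b :* u))
         refl (seq x i) (seq a i) (seq b i) (seq u i)) ⟩
  x * u - (x * a) * (b * u)  ≈⟨ +-congˡ (-‿cong (*-cong xa≈1 bu≈v)) ⟩
  x * u - 1ℝ * v             ≈⟨ +-congˡ (-‿cong (*-identityˡ v)) ⟩
  x * u - v                  ∎

-- In factored form, `x * u - v` contains the denominator `1ℝ - a * b` of `a ⊙ b`, which cancels;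
-- what remains is `(a + b) * (x * u)`.
⊙-*[x*u-v] : ∀ {x a b u v} (ab#1 : a * b # 1ℝ) → x * a ≈ 1ℝ → b * u ≈ v →
             a ⊙ b [ ab#1 ] * (x * u - v) ≈ u + x * v
⊙-*[x*u-v] {x} {a} {b} {u} {v} ab#1 xa≈1 bu≈v = begin
  (a + b) * r * (x * u - v)               ≈⟨ *-congˡ (x*u*[1-a*b] xa≈1 bu≈v) ⟨
  (a + b) * r * ((x * u) * (1ℝ - a * b))
    ≈⟨ pointwise⇒≈ (λ i → solve 5 (λ x a b u r →
         (a :+ b) :* r :* ((x :* u) :* (con 1ℚ :- a :* b)) :=
         ((x :* a) :* u :+ x :* (b :* u)) :* ((con 1ℚ :- a :* b) :* r))
         refl (seq x i) (seq a i) (seq b i) (seq u i) (seq r i)) ⟩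
  ((x * a) * u + x * (b * u)) * ((1ℝ - a * b) * r)
    ≈⟨ *-cong (+-cong (*-congʳ xa≈1) (*-congˡ bu≈v)) (*-recip (1ℝ - a * b) 1-ab#0) ⟩
  (1ℝ * u + x * v) * 1ℝ                   ≈⟨ *-identityʳ (1ℝ * u + x * v) ⟩
  1ℝ * u + x * v                          ≈⟨ +-cong (*-identityˡ u) ≈-refl ⟩
  u + x * v                               ∎
  where
  1-ab#0 = #⇒-#0 (#-sym ab#1)
  r = recip (1ℝ - a * b) 1-ab#0

-- The equation is kept free of division by `u`. Both claims go through one induction, since the
-- apartness at the next index relies on the equation at the current one.
power-*-u : ∀ n x (x#0 : x # 0ℝ) (d : PowerDefined (1ℝ / x [ x#0 ]) (suc n)) →
            u x (suc n) # 0ℝ × power (1ℝ / x [ x#0 ]) (suc n) d * u x (suc n) ≈ v x (suc n)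
-- At exponent 1, `u` computes to `x` and `v` to `1ℝ`.
power-*-u zero x x#0 d = x#0 , trans (*-comm (1ℝ / x [ x#0 ]) x) (*-1/ x x#0)
power-*-u (suc n) x x#0 (d , ab#1) =
  let u#0 , bu≈v  = power-*-u n x x#0 d
      u-suc , v-suc = u-v-suc x (suc n)
      xa≈1 = *-1/ x x#0
  -- The next `u` is a product of `x`, the current `u` and `1ℝ - a * b`. The last factor is apart
  -- from 0 exactly because the next power is defined.
  in #-congʳ (trans (x*u*[1-a*b] xa≈1 bu≈v) (sym u-suc))
       (x#0y#0→xy#0 (x#0y#0→xy#0 x#0 u#0) (#⇒-#0 (#-sym ab#1)))
   , trans (*-congˡ u-suc) (trans (⊙-*[x*u-v] ab#1 xa≈1 bu≈v) (sym v-suc))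

theorem1 : (n : ℕ) → 1 ≤ n → (x : ℝ) → x # 1ℝ → x # - 1ℝ → (x#0 : x # 0ℝ) →
    (d : PowerDefined (1ℝ / x [ x#0 ]) n) →
    Σ[ u#0 ∈ u x n # 0ℝ ] power (1ℝ / x [ x#0 ]) n d ≈ v x n / u x n [ u#0 ]
theorem1 (suc n) _ x _ _ x#0 d =
  let u#0 , power*u≈v = power-*-u n x x#0 d
  in u#0 , *≈⇒≈/ u#0 power*u≈v
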